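{- Let $\mathbb{F}_q$ be a finite field with $q$ elements and let $a(T),b(T)\in\mathbb{F}_q[T]$ be nonconstant monic polynomials. Fix any power $q^k$ of $q$ (with $k\ge 1$ an integer) and any congruence class $n_0\in\mathbb{Z}/q^k\mathbb{Z}$. Then there is a constant $c=c(a,b,q^k)>0$, depending only on $a$, $b$ and $q^k$, such that $$\deg\bigl(\gcd(a(T)^n-1,\,b(T)^n-1)\bigr)\ \ge\ c\,n$$ for infinitely many positive integers $n$ satisfying $n\equiv n_0 \pmod{q^k}$.
   Context: The gcd is taken in the polynomial ring $\mathbb{F}_q[T]$, and $\deg$ denotes the degree in $T$. -}

module Defs where

open import Algebra.Apartness.Bundles using (HeytingField; module HeytingCommutativeRing)
open import Algebra.Bundles using (CommutativeRing; RawRing)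
import Algebra.Definitions.RawSemiring as RawSemiringDefinitions
open import Data.Fin.Base using (Fin)
open import Data.List.Base using (List; []; _∷_; map)
open import Data.Nat.Base using (ℕ; zero; suc; _<_)
open import Data.Product.Base using (∃-syntax; _×_)
open import Function.Bundles using (Inverse)
open import Level using (_⊔_)
open import Relation.Binary.Core using (Rel)
import Relation.Binary.PropositionalEquality as ≡
open import Relation.Nullary.Negation.Core using (¬_)

-- Univariate polynomials over R as coefficient lists, constant term first.
-- Trailing zeros are allowed, so equality is coefficientwise and the degree
-- is not read off the length of the list.

module Polynomial {c ℓ} (R : RawRing c ℓ) where

  private module R = RawRing R
  open R using (Carrier)

  Poly : Set c
  Poly = List Carrier

  coeff : Poly → ℕ → Carrier
  coeff []      _       = R.0#
  coeff (x ∷ p) zero    = x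
  coeff (x ∷ p) (suc i) = coeff p i

  infix 4 _≈ₚ_

  _≈ₚ_ : Rel Poly ℓ
  p ≈ₚ q = ∀ i → coeff p i R.≈ coeff q i

  infixl 6 _+ₚ_
  infixl 7 _*ₚ_

  _+ₚ_ : Poly → Poly → Poly
  []      +ₚ q       = q
  (x ∷ p) +ₚ []      = x ∷ p
  (x ∷ p) +ₚ (y ∷ q) = (x R.+ y) ∷ (p +ₚ q)

  -- (x + T p) q = x q + T (p q)
  _*ₚ_ : Poly → Poly → Poly
  []      *ₚ q = []
  (x ∷ p) *ₚ q = map (x R.*_) q +ₚ (R.0# ∷ (p *ₚ q))

  polyRawRing : RawRing c ℓ
  polyRawRing = record
    { Carrier = Poly
    ; _≈_     = _≈ₚ_
    ; _+_     = _+ₚ_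
    ; _*_     = _*ₚ_
    ; -_      = map (R.-_)
    ; 0#      = []
    ; 1#      = R.1# ∷ []
    }

  open RawRing polyRawRing public using (_+_; _*_; -_; 0#; 1#)
  open RawSemiringDefinitions (RawRing.rawSemiring polyRawRing) public
    using (_^_; _∣_)

  infixl 6 _-_

  _-_ : Poly → Poly → Poly
  p - q = p + (- q)

  -- The zero polynomial has no degree.
  HasDegree : Poly → ℕ → Set ℓ
  HasDegree p d = ¬ (coeff p d R.≈ R.0#) × (∀ i → d < i → coeff p i R.≈ R.0#)

  Monic : Poly → Set ℓ
  Monic p = ∃[ d ] HasDegree p d × coeff p d R.≈ R.1#

  Nonconstant : Poly → Set ℓ
  Nonconstant p = ∃[ d ] 0 < d × HasDegree p d

  -- A gcd is unique up to a unit, hence its degree does not depend on the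
  -- choice.
  record IsGCD (p q g : Poly) : Set (c ⊔ ℓ) where
    field
      divides₁ : g ∣ p
      divides₂ : g ∣ q
      greatest : ∀ {h} → h ∣ p → h ∣ q → h ∣ g

-- For finite F the apartness of a Heyting field is the negation of equality
-- (invertibility is decidable by search), so these are the usual finite fields.

module Field {c ℓ₁ ℓ₂} (F : HeytingField c ℓ₁ ℓ₂) where

  open HeytingCommutativeRing (HeytingField.heytingCommutativeRing F)
    using (commutativeRing)
  open CommutativeRing commutativeRing using (setoid; rawRing)

  HasCardinality : ℕ → Set (c ⊔ ℓ₁)
  HasCardinality q = Inverse setoid (≡.setoid (Fin q))

  open Polynomial rawRing public

{-# OPTIONS --safe #-}
module Submission where

open import Defs
open import Algebra.Apartness.Bundles using (HeytingField)
open import Data.Integer.Base as ℤ using (ℤ; +_)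
open import Data.Integer.Divisibility as ℤ using ()
open import Data.Nat.Base as ℕ using (ℕ)
open import Data.Product.Base using (∃-syntax; _×_)
open import Data.Rational.Base as ℚ using (ℚ; 0ℚ; _/_)

open import Algebra.Apartness.Bundles using (module HeytingCommutativeRing)
import Algebra.Apartness.Properties.HeytingCommutativeRing as HeytingCommutativeRingProperties
open import Algebra.Bundles using (CommutativeMonoid; CommutativeRing; CommutativeSemigroup)
import Algebra.Consequences.Setoid as Consequences
import Algebra.Definitions.RawMagma as RawMagmaDefinitions
import Algebra.Morphism.Construct.Identity as Identity
open import Algebra.Morphism.Structures using (module RingMorphisms)
import Algebra.Properties.CommutativeMonoid.Sum as Sum
import Algebra.Properties.CommutativeSemigroup as CommutativeSemigroupProperties
import Algebra.Properties.CommutativeSemigroup.Divisibility as CommutativeDivisibility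
import Algebra.Properties.CommutativeSemiring.Exp as Exp
import Algebra.Properties.Ring as RingProperties
import Algebra.Properties.Semiring.Divisibility as Divisibility
import Algebra.Solver.Ring.NaturalCoefficients.Default as SemiringSolver
open import Data.Fin.Base using (Fin; zero; suc)
open import Data.Fin.Permutation using (Permutation′; permutation)
import Data.Fin.Properties as Fin
import Data.Integer.DivMod as ℤ
import Data.Integer.Divisibility.Signed as Signed
import Data.Integer.Properties as ℤ
open import Data.Integer.Solver using () renaming (module +-*-Solver to ℤ-Solver)
open import Data.List.Base using ([]; _∷_; length; map)
open import Data.Nat.Base using (zero; suc; z≤n; s≤s)
import Data.Nat.Properties as ℕ
open import Data.Nat.Solver using () renaming (module +-*-Solver to ℕ-Solver)
open import Data.Product.Base using (_,_; proj₁)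
import Data.Rational.Properties as ℚ
open import Data.Rational.Unnormalised.Base as ℚᵘ using (mkℚᵘ; *≤*)
import Data.Rational.Unnormalised.Properties as ℚᵘ
open import Data.Sum.Base using (_⊎_; inj₁; inj₂)
open import Data.Vec.Functional using (Vector; removeAt; replicate)
open import Function.Base using (_∘_)
open import Function.Bundles using (Inverse)
open import Level using (_⊔_)
open import Relation.Binary.Bundles using (Setoid)
open import Relation.Binary.Definitions using (Decidable; tri<; tri≈; tri>)
open import Relation.Binary.PropositionalEquality as ≡ using (_≡_; _≢_)
import Relation.Binary.Reasoning.Setoid as ≈-Reasoning
open import Relation.Binary.Structures using (IsEquivalence)
open import Relation.Nullary.Decidable using (yes; no; map′)
open import Relation.Nullary.Negation using (¬_; contradiction)

-- Let n = m (Q - 1), where Q = q^e with e ≥ k and m ≡ -n₀ (mod q^k), 1 ≤ m ≤ q^k,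
-- so that n ≡ n₀, and let D = T^Q - T. Since f(T)^Q = f(T^Q), D divides
-- f^Q - f = f (f^(Q-1) - 1) for every f, hence it divides a (a^n - 1) and
-- b (b^n - 1), hence also ab gcd(a^n - 1, b^n - 1). The degree of the gcd is
-- therefore at least Q - deg ab, which for large e exceeds Q/2 ≥ n/(2 q^k).
--
-- The Frobenius identity is proved without knowing that q is a prime power:
-- (c + T)^q - c - T^q has degree below q and vanishes at the q elements of F.

-- The polynomial D is the product of the monic irreducibles P whose degree divides e. Modulo such a
-- P the nonzero residues form a group of order dividing Q - 1, so P divides f^(Q-1) - 1 unless it
-- divides f. Handling D as a whole avoids any factorisation. The exceptional P, those dividing a or
-- b, are not removed from D but paid for by the factor a b, whose degree stays fixed while Q grows.
-- Since `IsGCD` says nothing directly about common divisors of a b (a^n - 1) and a b (b^n - 1), the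
-- gcd is built by Euclid's algorithm in the form `IsStrongGCD`. The exponent Q - 1 alone only
-- reaches the class of -1, as q^k divides Q. Its multiples by m keep the divisibility and reach
-- every class with m at most q^k, so n remains comparable to Q and e is free to grow.

-- The commutative ring of coefficient lists, equal up to trailing zeros.

module PolynomialRing {c ℓ} (R : CommutativeRing c ℓ) where

  private module R = CommutativeRing R
  open Polynomial R.rawRing
  open RingProperties R.ring using (-0#≈0#)

  -- p ≈ₚ q unfolds to a Π-type, from which p and q cannot be inferred.
  infix 4 _≋_

  record _≋_ (p q : Poly) : Set ℓ where
    constructor pointwise
    field at : p ≈ₚ q

  open _≋_ public

  scale : R.Carrier → Poly → Poly
  scale x = map (x R.*_)

  X : Poly
  X = R.0# ∷ R.1# ∷ []

  coeff-+ : ∀ p q i → coeff (p + q) i R.≈ coeff p i R.+ coeff q i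
  coeff-+ []      q       i       = R.sym (R.+-identityˡ _)
  coeff-+ (x ∷ p) []      i       = R.sym (R.+-identityʳ _)
  coeff-+ (x ∷ p) (y ∷ q) zero    = R.refl
  coeff-+ (x ∷ p) (y ∷ q) (suc i) = coeff-+ p q i

  coeff-scale : ∀ x p i → coeff (scale x p) i R.≈ x R.* coeff p i
  coeff-scale x []      i       = R.sym (R.zeroʳ x)
  coeff-scale x (y ∷ p) zero    = R.refl
  coeff-scale x (y ∷ p) (suc i) = coeff-scale x p i

  coeff-neg : ∀ p i → coeff (- p) i R.≈ R.- coeff p i
  coeff-neg []      i       = R.sym -0#≈0#
  coeff-neg (x ∷ p) zero    = R.refl
  coeff-neg (x ∷ p) (suc i) = coeff-neg p i

  private
    ≋-isEquivalence : IsEquivalence _≋_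
    ≋-isEquivalence = record
      { refl  = pointwise λ i → R.refl
      ; sym   = λ e → pointwise λ i → R.sym (at e i)
      ; trans = λ e f → pointwise λ i → R.trans (at e i) (at f i)
      }

    open IsEquivalence ≋-isEquivalence
      renaming (refl to ≋-refl; sym to ≋-sym; trans to ≋-trans)

    +-cong : ∀ {p p′ q q′} → p ≋ p′ → q ≋ q′ → p + q ≋ p′ + q′
    +-cong {p} {p′} {q} {q′} e f = pointwise λ i →
      R.trans (coeff-+ p q i)
        (R.trans (R.+-cong (at e i) (at f i)) (R.sym (coeff-+ p′ q′ i)))

    -‿cong : ∀ {p q} → p ≋ q → - p ≋ - q
    -‿cong {p} {q} e = pointwise λ i →
      R.trans (coeff-neg p i) (R.trans (R.-‿cong (at e i)) (R.sym (coeff-neg q i)))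

    +-assoc : ∀ p q r → (p + q) + r ≋ p + (q + r)
    +-assoc p q r = pointwise λ i → begin
      coeff (p + q + r) i                         ≈⟨ coeff-+ (p + q) r i ⟩
      coeff (p + q) i R.+ coeff r i               ≈⟨ R.+-congʳ (coeff-+ p q i) ⟩
      coeff p i R.+ coeff q i R.+ coeff r i       ≈⟨ R.+-assoc _ _ _ ⟩
      coeff p i R.+ (coeff q i R.+ coeff r i)     ≈⟨ R.+-congˡ (coeff-+ q r i) ⟨
      coeff p i R.+ coeff (q + r) i               ≈⟨ coeff-+ p (q + r) i ⟨
      coeff (p + (q + r)) i                       ∎
      where open ≈-Reasoning R.setoid

    +-comm : ∀ p q → p + q ≋ q + p
    +-comm p q = pointwise λ i →
      R.trans (coeff-+ p q i) (R.trans (R.+-comm _ _) (R.sym (coeff-+ q p i)))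

    +-identityʳ : ∀ p → p + [] ≋ p
    +-identityʳ []      = ≋-refl
    +-identityʳ (x ∷ p) = ≋-refl

    -‿inverseʳ : ∀ p → p + (- p) ≋ []
    -‿inverseʳ p = pointwise λ i →
      R.trans (coeff-+ p (- p) i)
        (R.trans (R.+-congˡ (coeff-neg p i)) (R.-‿inverseʳ _))

  ∷-cong : ∀ {x y p q} → x R.≈ y → p ≋ q → x ∷ p ≋ y ∷ q
  ∷-cong e f = pointwise λ { zero → e ; (suc i) → at f i }

  ∷-≋[] : ∀ {x p} → x R.≈ R.0# → p ≋ [] → x ∷ p ≋ []
  ∷-≋[] e f = pointwise λ { zero → e ; (suc i) → at f i }

  head-≋[] : ∀ {x p} → x ∷ p ≋ [] → x R.≈ R.0#
  head-≋[] e = at e zero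

  tail-≋[] : ∀ {x p} → x ∷ p ≋ [] → p ≋ []
  tail-≋[] e = pointwise λ i → at e (suc i)

  head-≋ : ∀ {x p y q} → x ∷ p ≋ y ∷ q → x R.≈ y
  head-≋ e = at e zero

  tail-≋ : ∀ {x p y q} → x ∷ p ≋ y ∷ q → p ≋ q
  tail-≋ e = pointwise λ i → at e (suc i)

  private
    scale-cong : ∀ {x y p q} → x R.≈ y → p ≋ q → scale x p ≋ scale y q
    scale-cong {x} {y} {p} {q} e f = pointwise λ i →
      R.trans (coeff-scale x p i)
        (R.trans (R.*-cong e (at f i)) (R.sym (coeff-scale y q i)))

    scale-0 : ∀ p → scale R.0# p ≋ []
    scale-0 p = pointwise λ i → R.trans (coeff-scale R.0# p i) (R.zeroˡ _)

    scale-1 : ∀ p → scale R.1# p ≋ p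
    scale-1 p = pointwise λ i → R.trans (coeff-scale R.1# p i) (R.*-identityˡ _)

    scale-+ : ∀ x p q → scale x (p + q) ≋ scale x p + scale x q
    scale-+ x p q = pointwise λ i → begin
      coeff (scale x (p + q)) i                   ≈⟨ coeff-scale x (p + q) i ⟩
      x R.* coeff (p + q) i                       ≈⟨ R.*-congˡ (coeff-+ p q i) ⟩
      x R.* (coeff p i R.+ coeff q i)             ≈⟨ R.distribˡ _ _ _ ⟩
      x R.* coeff p i R.+ x R.* coeff q i
        ≈⟨ R.+-cong (coeff-scale x p i) (coeff-scale x q i) ⟨
      coeff (scale x p) i R.+ coeff (scale x q) i ≈⟨ coeff-+ (scale x p) (scale x q) i ⟨
      coeff (scale x p + scale x q) i             ∎
      where open ≈-Reasoning R.setoid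

    +-scale : ∀ x y p → scale (x R.+ y) p ≋ scale x p + scale y p
    +-scale x y p = pointwise λ i → begin
      coeff (scale (x R.+ y) p) i                 ≈⟨ coeff-scale (x R.+ y) p i ⟩
      (x R.+ y) R.* coeff p i                     ≈⟨ R.distribʳ _ _ _ ⟩
      x R.* coeff p i R.+ y R.* coeff p i
        ≈⟨ R.+-cong (coeff-scale x p i) (coeff-scale y p i) ⟨
      coeff (scale x p) i R.+ coeff (scale y p) i ≈⟨ coeff-+ (scale x p) (scale y p) i ⟨
      coeff (scale x p + scale y p) i             ∎
      where open ≈-Reasoning R.setoid

    scale-scale : ∀ x y p → scale (x R.* y) p ≋ scale x (scale y p)
    scale-scale x y p = pointwise λ i → begin
      coeff (scale (x R.* y) p) i     ≈⟨ coeff-scale (x R.* y) p i ⟩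
      x R.* y R.* coeff p i           ≈⟨ R.*-assoc _ _ _ ⟩
      x R.* (y R.* coeff p i)         ≈⟨ R.*-congˡ (coeff-scale y p i) ⟨
      x R.* coeff (scale y p) i       ≈⟨ coeff-scale x (scale y p) i ⟨
      coeff (scale x (scale y p)) i   ∎
      where open ≈-Reasoning R.setoid

    +-shift : ∀ p q → (R.0# ∷ p) + (R.0# ∷ q) ≋ R.0# ∷ (p + q)
    +-shift p q = ∷-cong (R.+-identityʳ R.0#) ≋-refl

    setoid : Setoid c ℓ
    setoid = record { isEquivalence = ≋-isEquivalence }

    +-commutativeSemigroup : CommutativeSemigroup c ℓ
    +-commutativeSemigroup = record
      { isCommutativeSemigroup = record
        { isSemigroup = record
          { isMagma = record { isEquivalence = ≋-isEquivalence ; ∙-cong = +-cong }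
          ; assoc   = +-assoc
          }
        ; comm = +-comm
        }
      }

    open CommutativeSemigroupProperties +-commutativeSemigroup
      using (interchange; x∙yz≈y∙xz)
    open ≈-Reasoning setoid

    zeroʳ : ∀ p → p * [] ≋ []
    zeroʳ []      = ≋-refl
    zeroʳ (x ∷ p) = ∷-≋[] R.refl (zeroʳ p)

    -- Equal polynomials may be lists of different lengths. Once the recursion of `*-congʳ` exhausts
    -- one list, the rest of the other consists of zeros, and this case remains.
    *-zeroˡ-cong : ∀ {p} q → p ≋ [] → p * q ≋ []
    *-zeroˡ-cong {[]}    q e = ≋-refl
    *-zeroˡ-cong {x ∷ p} q e = begin
      scale x q + (R.0# ∷ p * q)
        ≈⟨ +-cong (scale-cong {q = q} (head-≋[] e) ≋-refl)
                  (∷-≋[] R.refl (*-zeroˡ-cong q (tail-≋[] e))) ⟩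
      scale R.0# q + []           ≈⟨ +-identityʳ _ ⟩
      scale R.0# q                ≈⟨ scale-0 q ⟩
      []                          ∎

    *-congˡ : ∀ p {q r} → q ≋ r → p * q ≋ p * r
    *-congˡ []      e = ≋-refl
    *-congˡ (x ∷ p) e = +-cong (scale-cong R.refl e) (∷-cong R.refl (*-congˡ p e))

    *-congʳ : ∀ {p p′} q → p ≋ p′ → p * q ≋ p′ * q
    *-congʳ {[]}    {p′}     q e = ≋-sym (*-zeroˡ-cong q (≋-sym e))
    *-congʳ {x ∷ p} {[]}     q e = *-zeroˡ-cong q e
    *-congʳ {x ∷ p} {y ∷ p′} q e =
      +-cong (scale-cong {q = q} (head-≋ e) ≋-refl)
             (∷-cong R.refl (*-congʳ q (tail-≋ e)))

    *-cong : ∀ {p p′ q q′} → p ≋ p′ → q ≋ q′ → p * q ≋ p′ * q′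
    *-cong {p′ = p′} {q} e f = ≋-trans (*-congʳ q e) (*-congˡ p′ f)

    distribʳ : ∀ q p p′ → (p + p′) * q ≋ p * q + p′ * q
    distribʳ q []      p′       = ≋-refl
    distribʳ q (x ∷ p) []       = ≋-sym (+-identityʳ _)
    distribʳ q (x ∷ p) (y ∷ p′) = begin
      scale (x R.+ y) q + (R.0# ∷ (p + p′) * q)
        ≈⟨ +-cong (+-scale x y q) (∷-cong R.refl (distribʳ q p p′)) ⟩
      (scale x q + scale y q) + (R.0# ∷ (p * q + p′ * q))
        ≈⟨ +-cong {p = scale x q + scale y q} ≋-refl (+-shift (p * q) (p′ * q)) ⟨
      (scale x q + scale y q) + ((R.0# ∷ p * q) + (R.0# ∷ p′ * q))
        ≈⟨ interchange (scale x q) (scale y q) _ _ ⟩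
      (scale x q + (R.0# ∷ p * q)) + (scale y q + (R.0# ∷ p′ * q)) ∎

    -- The mirror image of the defining equation of `_*ₚ_`, which recurses on the left factor only;
    -- commutativity follows from it by induction.
    *-∷ : ∀ p y q → p * (y ∷ q) ≋ scale y p + (R.0# ∷ p * q)
    *-∷ []      y q = ≋-sym (∷-≋[] R.refl ≋-refl)
    *-∷ (x ∷ p) y q = ∷-cong (R.+-congʳ (R.*-comm x y)) (begin
      scale x q + p * (y ∷ q)
        ≈⟨ +-cong {p = scale x q} ≋-refl (*-∷ p y q) ⟩
      scale x q + (scale y p + (R.0# ∷ p * q))
        ≈⟨ x∙yz≈y∙xz (scale x q) (scale y p) _ ⟩
      scale y p + (scale x q + (R.0# ∷ p * q)) ∎)

    *-comm : ∀ p q → p * q ≋ q * p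
    *-comm []      q = ≋-sym (zeroʳ q)
    *-comm (x ∷ p) q = begin
      scale x q + (R.0# ∷ p * q)
        ≈⟨ +-cong {p = scale x q} ≋-refl (∷-cong R.refl (*-comm p q)) ⟩
      scale x q + (R.0# ∷ q * p)  ≈⟨ *-∷ q x p ⟨
      q * (x ∷ p)                 ∎

    shift-* : ∀ p q → (R.0# ∷ p) * q ≋ R.0# ∷ p * q
    shift-* p q = +-cong {p′ = []} (scale-0 q) ≋-refl

    scale-* : ∀ x p q → scale x p * q ≋ scale x (p * q)
    scale-* x []      q = ≋-refl
    scale-* x (y ∷ p) q = begin
      scale (x R.* y) q + (R.0# ∷ scale x p * q)
        ≈⟨ +-cong (scale-scale x y q) (∷-cong (R.sym (R.zeroʳ x)) (scale-* x p q)) ⟩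
      scale x (scale y q) + scale x (R.0# ∷ p * q)
        ≈⟨ scale-+ x (scale y q) (R.0# ∷ p * q) ⟨
      scale x (scale y q + (R.0# ∷ p * q)) ∎

    *-assoc : ∀ p q r → (p * q) * r ≋ p * (q * r)
    *-assoc []      q r = ≋-refl
    *-assoc (x ∷ p) q r = begin
      (scale x q + (R.0# ∷ p * q)) * r      ≈⟨ distribʳ r (scale x q) _ ⟩
      scale x q * r + (R.0# ∷ p * q) * r
        ≈⟨ +-cong (scale-* x q r) (≋-trans (shift-* (p * q) r) (∷-cong R.refl (*-assoc p q r))) ⟩
      scale x (q * r) + (R.0# ∷ p * (q * r)) ∎

    *-identityˡ : ∀ p → 1# * p ≋ p
    *-identityˡ p = begin
      scale R.1# p + (R.0# ∷ []) ≈⟨ +-cong (scale-1 p) (∷-≋[] R.refl ≋-refl) ⟩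
      p + []                     ≈⟨ +-identityʳ p ⟩
      p                          ∎

    open Consequences setoid
      using (comm∧idˡ⇒id; comm∧invʳ⇒inv; comm∧distrʳ⇒distr)

  polyCommutativeRing : CommutativeRing c ℓ
  polyCommutativeRing = record
    { Carrier = Poly
    ; _≈_     = _≋_
    ; _+_     = _+_
    ; _*_     = _*_
    ; -_      = -_
    ; 0#      = 0#
    ; 1#      = 1#
    ; isCommutativeRing = record
      { isRing = record
        { +-isAbelianGroup = record
          { isGroup = record
            { isMonoid = record
              { isSemigroup = record
                { isMagma = record { isEquivalence = ≋-isEquivalence ; ∙-cong = +-cong }
                ; assoc   = +-assoc
                }
              ; identity = (λ p → ≋-refl) , +-identityʳ
              }
            ; inverse = comm∧invʳ⇒inv +-comm -‿inverseʳ
            ; ⁻¹-cong = -‿cong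
            }
          ; comm = +-comm
          }
        ; *-cong     = *-cong
        ; *-assoc    = *-assoc
        ; *-identity = comm∧idˡ⇒id *-comm *-identityˡ
        ; distrib    = comm∧distrʳ⇒distr +-cong *-comm distribʳ
        }
      ; *-comm = *-comm
      }
    }

  module P = CommutativeRing polyCommutativeRing
  open Exp P.commutativeSemiring public using () renaming (_^_ to _^ᴾ_)

  -- The laws of exponents are available for the ring with equality `_≋_`, while the theorem speaks
  -- of the power of the raw ring; this carries the result over.
  ^ᴾ≡^ : ∀ p n → p ^ᴾ n ≡ p ^ n
  ^ᴾ≡^ p zero    = ≡.refl
  ^ᴾ≡^ p (suc n) = ≡.cong (p *_) (^ᴾ≡^ p n)

  const : R.Carrier → Poly
  const x = x ∷ []

  -- Makes R[T] an R-algebra, so that `Evaluation` can substitute a polynomial for T.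
  const-isRingHomomorphism :
    RingMorphisms.IsRingHomomorphism R.rawRing P.rawRing const
  const-isRingHomomorphism = record
    { isSemiringHomomorphism = record
      { isNearSemiringHomomorphism = record
        { +-isMonoidHomomorphism = record
          { isMagmaHomomorphism = record
            { isRelHomomorphism = record { cong = λ e → ∷-cong e ≋-refl }
            ; homo = λ x y → ≋-refl
            }
          ; ε-homo = ∷-≋[] R.refl ≋-refl
          }
        ; *-homo = λ x y → ∷-cong (R.sym (R.+-identityʳ _)) ≋-refl
        }
      ; 1#-homo = ≋-refl
      }
    ; -‿homo = λ x → ≋-refl
    }

  -- Brings a cons cell into the shape constant plus g to which the Frobenius identity applies.
  ∷-≋-const+X* : ∀ x p → x ∷ p ≋ const x + X * p
  ∷-≋-const+X* x p = begin
    x ∷ p                  ≈⟨ ∷-cong (R.sym (R.+-identityʳ x)) (≋-sym (*-identityˡ p)) ⟩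
    const x + (R.0# ∷ 1# * p) ≈⟨ +-cong {p = const x} ≋-refl (shift-* 1# p) ⟨
    const x + X * p        ∎

-- Degree bounds and leading coefficients of products and powers.

module PolynomialDegree {c ℓ} (R : CommutativeRing c ℓ) where

  private module R = CommutativeRing R
  open Polynomial R.rawRing
  open PolynomialRing R
  open ≈-Reasoning R.setoid

  -- Below d p says deg p < d, with deg 0 = -∞.
  Below : ℕ → Poly → Set ℓ
  Below d p = ∀ i → d ℕ.≤ i → coeff p i R.≈ R.0#

  Below-0 : ∀ {p} → Below 0 p → p ≋ []
  Below-0 b = pointwise λ i → b i z≤n

  Below-length : ∀ p → Below (length p) p
  Below-length []      i       _         = R.refl
  Below-length (x ∷ p) (suc i) (s≤s p≤i) = Below-length p i p≤i

  Below-pred : ∀ {d p} → Below (suc d) p → coeff p d R.≈ R.0# → Below d p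
  Below-pred {d} b e i d≤i with ℕ.m≤n⇒m<n∨m≡n d≤i
  ... | inj₁ d<i  = b i d<i
  ... | inj₂ ≡.refl = e

  private
    coeff-∷-* : ∀ x p q i →
      coeff ((x ∷ p) * q) (suc i) R.≈ x R.* coeff q (suc i) R.+ coeff (p * q) i
    coeff-∷-* x p q i =
      R.trans (coeff-+ (scale x q) _ (suc i)) (R.+-congʳ (coeff-scale x q (suc i)))

    -- The base case of the two inductions below: the tail satisfies only `Below 0`, which is not of
    -- the form `Below (suc m)` that the induction hypothesis takes, but it is then zero.
    tail-* : ∀ x p q → Below 1 (x ∷ p) → p * q ≋ []
    tail-* x p q bp =
      P.trans (P.*-congʳ (Below-0 {p} λ i _ → bp (suc i) (s≤s z≤n))) (P.zeroˡ q)

  -- `Below (suc m)` means degree at most m, and in this form the bounds add. Coefficient i + 1 of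
  -- (x + T p) q is x times coefficient i + 1 of q plus coefficient i of p q: for m > 0 the first
  -- term vanishes in the relevant range and the second is the induction hypothesis.
  Below-* : ∀ {m n} p q → Below (suc m) p → Below (suc n) q →
            Below (suc (m ℕ.+ n)) (p * q)
  coeff-*-top : ∀ {m n} p q → Below (suc m) p → Below (suc n) q →
                coeff (p * q) (m ℕ.+ n) R.≈ coeff p m R.* coeff q n
  Below-* [] q bp bq i i> = R.refl
  Below-* {zero} (x ∷ p) q bp bq (suc i) (s≤s n≤i) = begin
    coeff ((x ∷ p) * q) (suc i) ≈⟨ coeff-∷-* x p q i ⟩
    x R.* coeff q (suc i) R.+ coeff (p * q) i
      ≈⟨ R.+-cong (R.*-congˡ (bq _ (s≤s n≤i)))
           (at (tail-* x p q bp) i) ⟩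
    x R.* R.0# R.+ R.0# ≈⟨ R.+-identityʳ _ ⟩
    x R.* R.0#          ≈⟨ R.zeroʳ x ⟩
    R.0#                ∎
  Below-* {suc m} (x ∷ p) q bp bq (suc i) (s≤s m+n<i) = begin
    coeff ((x ∷ p) * q) (suc i) ≈⟨ coeff-∷-* x p q i ⟩
    x R.* coeff q (suc i) R.+ coeff (p * q) i
      ≈⟨ R.+-cong (R.*-congˡ (bq _ (s≤s (ℕ.≤-trans (ℕ.m≤n+m _ (suc m)) m+n<i))))
           (Below-* p q (λ j m<j → bp (suc j) (s≤s m<j)) bq i m+n<i) ⟩
    x R.* R.0# R.+ R.0# ≈⟨ R.+-identityʳ _ ⟩
    x R.* R.0#          ≈⟨ R.zeroʳ x ⟩
    R.0#                ∎

  coeff-*-top [] q bp bq = R.sym (R.zeroˡ _)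
  coeff-*-top {zero} {n} (x ∷ p) q bp bq = begin
    coeff ((x ∷ p) * q) n ≈⟨ coeff-+ (scale x q) _ n ⟩
    coeff (scale x q) n R.+ coeff (R.0# ∷ p * q) n
      ≈⟨ R.+-cong (coeff-scale x q n)
           (at (∷-≋[] R.refl (tail-* x p q bp)) n) ⟩
    x R.* coeff q n R.+ R.0# ≈⟨ R.+-identityʳ _ ⟩
    x R.* coeff q n          ∎
  coeff-*-top {suc m} {n} (x ∷ p) q bp bq = begin
    coeff ((x ∷ p) * q) (suc (m ℕ.+ n)) ≈⟨ coeff-∷-* x p q (m ℕ.+ n) ⟩
    x R.* coeff q (suc (m ℕ.+ n)) R.+ coeff (p * q) (m ℕ.+ n)
      ≈⟨ R.+-cong (R.*-congˡ (bq _ (s≤s (ℕ.m≤n+m n m))))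
           (coeff-*-top p q (λ j m<j → bp (suc j) (s≤s m<j)) bq) ⟩
    x R.* R.0# R.+ coeff p m R.* coeff q n ≈⟨ R.+-congʳ (R.zeroʳ x) ⟩
    R.0# R.+ coeff p m R.* coeff q n       ≈⟨ R.+-identityˡ _ ⟩
    coeff p m R.* coeff q n                ∎

  Below-^ : ∀ {m} p n → Below (suc m) p → Below (suc (n ℕ.* m)) (p ^ᴾ n)
  Below-^ p zero    bp (suc i) _ = R.refl
  Below-^ p (suc n) bp = Below-* p (p ^ᴾ n) bp (Below-^ p n bp)

  coeff-^-top : ∀ {m} p n → Below (suc m) p → coeff p m R.≈ R.1# →
                coeff (p ^ᴾ n) (n ℕ.* m) R.≈ R.1#
  coeff-^-top p zero    bp e = R.refl
  coeff-^-top {m} p (suc n) bp e = begin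
    coeff (p * p ^ᴾ n) (m ℕ.+ n ℕ.* m)
      ≈⟨ coeff-*-top p (p ^ᴾ n) bp (Below-^ p n bp) ⟩
    coeff p m R.* coeff (p ^ᴾ n) (n ℕ.* m)
      ≈⟨ R.*-cong e (coeff-^-top p n bp e) ⟩
    R.1# R.* R.1# ≈⟨ R.*-identityˡ _ ⟩
    R.1#          ∎

-- Substitution homomorphisms from R[T] to an R-algebra.

module Evaluation
  {c₁ ℓ₁ c₂ ℓ₂} (R : CommutativeRing c₁ ℓ₁) (A : CommutativeRing c₂ ℓ₂)
  {φ : CommutativeRing.Carrier R → CommutativeRing.Carrier A}
  (φ-hom : RingMorphisms.IsRingHomomorphism
    (CommutativeRing.rawRing R) (CommutativeRing.rawRing A) φ)
  (t : CommutativeRing.Carrier A)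
  where

  private
    module R = CommutativeRing R
    module A = CommutativeRing A
  open Polynomial R.rawRing
  open PolynomialRing R
  open RingMorphisms.IsRingHomomorphism φ-hom using (⟦⟧-cong; +-homo; *-homo; 0#-homo; 1#-homo)
  open A using (_≈_)
  open Exp A.commutativeSemiring using () renaming (_^_ to _^ᴬ_)
  open ≈-Reasoning A.setoid
  private
    module +-CS = CommutativeSemigroupProperties
      (CommutativeMonoid.commutativeSemigroup A.+-commutativeMonoid)
    module *-CS = CommutativeSemigroupProperties A.*-commutativeSemigroup

  -- Horner's scheme. The target is general because it is used twice: with A = R to speak of roots,
  -- and with A = R[T] to substitute a polynomial for T.
  eval : Poly → A.Carrier
  eval []      = A.0#
  eval (x ∷ p) = φ x A.+ t A.* eval p

  eval-≋[] : ∀ {p} → p ≋ [] → eval p ≈ A.0#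
  eval-≋[] {[]}    e = A.refl
  eval-≋[] {x ∷ p} e = begin
    φ x A.+ t A.* eval p
      ≈⟨ A.+-cong (A.trans (⟦⟧-cong (head-≋[] e)) 0#-homo) (A.*-congˡ (eval-≋[] (tail-≋[] e))) ⟩
    A.0# A.+ t A.* A.0# ≈⟨ A.+-identityˡ _ ⟩
    t A.* A.0#          ≈⟨ A.zeroʳ t ⟩
    A.0#                ∎

  eval-cong : ∀ {p q} → p ≋ q → eval p ≈ eval q
  eval-cong {[]}    {q}     e = A.sym (eval-≋[] (P.sym e))
  eval-cong {x ∷ p} {[]}    e = eval-≋[] e
  eval-cong {x ∷ p} {y ∷ q} e =
    A.+-cong (⟦⟧-cong (head-≋ e)) (A.*-congˡ (eval-cong (tail-≋ e)))

  eval-+ : ∀ p q → eval (p + q) ≈ eval p A.+ eval q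
  eval-+ []      q       = A.sym (A.+-identityˡ _)
  eval-+ (x ∷ p) []      = A.sym (A.+-identityʳ _)
  eval-+ (x ∷ p) (y ∷ q) = begin
    φ (x R.+ y) A.+ t A.* eval (p + q)
      ≈⟨ A.+-cong (+-homo x y) (A.trans (A.*-congˡ (eval-+ p q)) (A.distribˡ _ _ _)) ⟩
    (φ x A.+ φ y) A.+ (t A.* eval p A.+ t A.* eval q)
      ≈⟨ +-CS.interchange _ _ _ _ ⟩
    (φ x A.+ t A.* eval p) A.+ (φ y A.+ t A.* eval q) ∎

  eval-scale : ∀ x p → eval (scale x p) ≈ φ x A.* eval p
  eval-scale x []      = A.sym (A.zeroʳ _)
  eval-scale x (y ∷ p) = begin
    φ (x R.* y) A.+ t A.* eval (scale x p)
      ≈⟨ A.+-cong (*-homo x y) (A.*-congˡ (eval-scale x p)) ⟩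
    φ x A.* φ y A.+ t A.* (φ x A.* eval p)
      ≈⟨ A.+-congˡ (*-CS.x∙yz≈y∙xz _ _ _) ⟩
    φ x A.* φ y A.+ φ x A.* (t A.* eval p)
      ≈⟨ A.distribˡ _ _ _ ⟨
    φ x A.* (φ y A.+ t A.* eval p) ∎

  eval-* : ∀ p q → eval (p * q) ≈ eval p A.* eval q
  eval-* []      q = A.sym (A.zeroˡ _)
  eval-* (x ∷ p) q = begin
    eval (scale x q + (R.0# ∷ p * q))
      ≈⟨ eval-+ (scale x q) _ ⟩
    eval (scale x q) A.+ (φ R.0# A.+ t A.* eval (p * q))
      ≈⟨ A.+-cong (eval-scale x q)
           (A.trans (A.+-congʳ 0#-homo) (A.trans (A.+-identityˡ _) (A.*-congˡ (eval-* p q)))) ⟩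
    φ x A.* eval q A.+ t A.* (eval p A.* eval q)
      ≈⟨ A.+-congˡ (A.*-assoc _ _ _) ⟨
    φ x A.* eval q A.+ t A.* eval p A.* eval q
      ≈⟨ A.distribʳ _ _ _ ⟨
    (φ x A.+ t A.* eval p) A.* eval q ∎

  eval-const : ∀ x → eval (const x) ≈ φ x
  eval-const x = A.trans (A.+-congˡ (A.zeroʳ t)) (A.+-identityʳ _)

  eval-^ : ∀ p n → eval (p ^ᴾ n) ≈ eval p ^ᴬ n
  eval-^ p zero    = A.trans (eval-const R.1#) 1#-homo
  eval-^ p (suc n) = A.trans (eval-* p (p ^ᴾ n)) (A.*-congˡ (eval-^ p n))

  eval-const+X : ∀ x → eval (x ∷ R.1# ∷ []) ≈ φ x A.+ t
  eval-const+X x = A.+-congˡ (begin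
    t A.* eval (const R.1#) ≈⟨ A.*-congˡ (A.trans (eval-const R.1#) 1#-homo) ⟩
    t A.* A.1#              ≈⟨ A.*-identityʳ t ⟩
    t                       ∎)

-- Divisibility in a commutative ring.

module RingDivisibility {c ℓ} (A : CommutativeRing c ℓ) where

  open CommutativeRing A
  open RingProperties ring using ([y-z]x≈yx-zx; x[y-z]≈xy-xz; xyx⁻¹≈y)
  open Divisibility semiring public
    using (_∣_; _,_; ∣ʳ-refl; ∣ʳ-trans; ∣ʳ-respʳ-≈; ∣ʳ-respˡ-≈; x∣ʳy⇒x∣ʳzy; 0∣x⇒x≈0)
  open Exp commutativeSemiring using (_^_)
  open ≈-Reasoning setoid

  ∣-+ : ∀ {d x y} → d ∣ x → d ∣ y → d ∣ x + y
  ∣-+ (s , sd≈x) (t , td≈y) = s + t , trans (distribʳ _ s t) (+-cong sd≈x td≈y)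

  ∣-+-cancelˡ : ∀ {d x y} → d ∣ x → d ∣ x + y → d ∣ y
  ∣-+-cancelˡ {d} {x} {y} (s , sd≈x) (t , td≈x+y) = t - s , (begin
    (t - s) * d   ≈⟨ [y-z]x≈yx-zx d t s ⟩
    t * d - s * d ≈⟨ +-cong td≈x+y (-‿cong sd≈x) ⟩
    x + y - x     ≈⟨ xyx⁻¹≈y x y ⟩
    y             ∎)

  -- Induction by x^(n+1) - 1 = x (x^n - 1) + (x - 1). With x = f^(Q-1) it passes from the exponent
  -- Q - 1 to its multiples.
  x-1∣x^n-1 : ∀ x n → x - 1# ∣ x ^ n - 1#
  x-1∣x^n-1 x zero    = 0# , trans (zeroˡ _) (sym (-‿inverseʳ 1#))
  x-1∣x^n-1 x (suc n) =
    ∣ʳ-respʳ-≈ telescope (∣-+ (x∣ʳy⇒x∣ʳzy x (x-1∣x^n-1 x n)) ∣ʳ-refl)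
    where
    telescope : x * (x ^ n - 1#) + (x - 1#) ≈ x * x ^ n - 1#
    telescope = begin
      x * (x ^ n - 1#) + (x - 1#)         ≈⟨ +-congʳ (x[y-z]≈xy-xz x _ _) ⟩
      x * x ^ n - x * 1# + (x - 1#)       ≈⟨ +-congʳ (+-congˡ (-‿cong (*-identityʳ x))) ⟩
      x * x ^ n - x + (x - 1#)            ≈⟨ +-assoc _ _ _ ⟩
      x * x ^ n + (- x + (x - 1#))        ≈⟨ +-congˡ (+-assoc _ _ _) ⟨
      x * x ^ n + (- x + x - 1#)          ≈⟨ +-congˡ (+-congʳ (-‿inverseˡ x)) ⟩
      x * x ^ n + (0# - 1#)               ≈⟨ +-congˡ (+-identityˡ _) ⟩
      x * x ^ n - 1#                      ∎

  -- A gcd in the strong form that Bézout's identity gives: it survives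
  -- multiplication by any z.
  record IsStrongGCD (x y g : Carrier) : Set (c ⊔ ℓ) where
    field
      divides₁ : g ∣ x
      divides₂ : g ∣ y
      greatest : ∀ {d} z → d ∣ z * x → d ∣ z * y → d ∣ z * g

-- Polynomials over a field with decidable equality: degrees, Euclidean division and gcds.

HasInverses : ∀ {c ℓ} → CommutativeRing c ℓ → Set (c ⊔ ℓ)
HasInverses R = ∀ {x} → ¬ x ≈ 0# → ∃[ y ] y * x ≈ 1#
  where open CommutativeRing R

module DiscreteField {c ℓ} (R : CommutativeRing c ℓ)
  (_≟_ : Decidable (CommutativeRing._≈_ R)) (inverse : HasInverses R) where

  private module R = CommutativeRing R
  open Polynomial R.rawRing
  open PolynomialRing R
  open PolynomialDegree R
  open RingDivisibility polyCommutativeRing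
    using (IsStrongGCD; _,_; ∣ʳ-refl; ∣-+; ∣-+-cancelˡ; x∣ʳy⇒x∣ʳzy; ∣ʳ-respʳ-≈)
    renaming (_∣_ to _∣ᴾ_)

  *-cancelˡ-≉0 : ∀ {x y z} → ¬ x R.≈ R.0# → x R.* y R.≈ x R.* z → y R.≈ z
  *-cancelˡ-≉0 {x} {y} {z} x≉0 e with x⁻¹ , x⁻¹x≈1 ← inverse x≉0 = begin
    y                   ≈⟨ R.*-identityˡ y ⟨
    R.1# R.* y          ≈⟨ R.*-congʳ x⁻¹x≈1 ⟨
    x⁻¹ R.* x R.* y     ≈⟨ R.*-assoc _ _ _ ⟩
    x⁻¹ R.* (x R.* y)   ≈⟨ R.*-congˡ e ⟩
    x⁻¹ R.* (x R.* z)   ≈⟨ R.*-assoc _ _ _ ⟨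
    x⁻¹ R.* x R.* z     ≈⟨ R.*-congʳ x⁻¹x≈1 ⟩
    R.1# R.* z          ≈⟨ R.*-identityˡ z ⟩
    z                   ∎
    where open ≈-Reasoning R.setoid

  *-≉0 : ∀ {x y} → ¬ x R.≈ R.0# → ¬ y R.≈ R.0# → ¬ x R.* y R.≈ R.0#
  *-≉0 x≉0 y≉0 xy≈0 = y≉0 (*-cancelˡ-≉0 x≉0 (R.trans xy≈0 (R.sym (R.zeroʳ _))))

  HasDegree-* : ∀ {p q m n} → HasDegree p m → HasDegree q n → HasDegree (p * q) (m ℕ.+ n)
  HasDegree-* {p} {q} (p≉0 , bp) (q≉0 , bq) =
    (λ e → *-≉0 p≉0 q≉0 (R.trans (R.sym (coeff-*-top p q bp bq)) e)) , Below-* p q bp bq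

  HasDegree-^ : ∀ {p m} → HasDegree p m → ∀ n → HasDegree (p ^ᴾ n) (n ℕ.* m)
  HasDegree-^ {p} (p≉0 , bp) zero =
    -- `HasInverses` does not exclude the zero ring, so 1 ≠ 0 is obtained from the nonzero leading
    -- coefficient of p.
    (λ 1≈0 → p≉0
      (R.trans (R.sym (R.*-identityˡ _)) (R.trans (R.*-congʳ 1≈0) (R.zeroˡ _)))) ,
    λ { (suc i) _ → R.refl }
  HasDegree-^ {p} hp (suc n) = HasDegree-* {p} {p ^ᴾ n} hp (HasDegree-^ {p} hp n)

  HasDegree-unique : ∀ {p q m n} → p ≋ q → HasDegree p m → HasDegree q n → m ≡ n
  HasDegree-unique {m = m} {n} p≋q (p≉0 , bp) (q≉0 , bq) with ℕ.<-cmp m n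
  ... | tri< m<n _ _ = contradiction (R.trans (R.sym (at p≋q n)) (bp n m<n)) q≉0
  ... | tri≈ _ m≡n _ = m≡n
  ... | tri> _ _ n<m = contradiction (R.trans (at p≋q m) (bq m n<m)) p≉0

  degree? : ∀ p → p ≋ [] ⊎ (∃[ d ] HasDegree p d)
  degree? []      = inj₁ P.refl
  degree? (x ∷ p) with degree? p | x ≟ R.0#
  ... | inj₂ (d , p≉0 , bp) | _       = inj₂ (suc d , p≉0 , λ { (suc i) (s≤s d<i) → bp i d<i })
  ... | inj₁ p≋[]           | yes x≈0 = inj₁ (∷-≋[] x≈0 p≋[])
  ... | inj₁ p≋[]           | no x≉0  = inj₂ (0 , x≉0 , λ { (suc i) _ → at p≋[] i })

  -- Long division by induction on the coefficient list: if p = s g + r, then x + T p = (T s) g + (x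
  -- + T r), where x + T r has degree at most e. Subtracting k g, with k chosen to cancel the
  -- coefficient at e, restores the bound, and k becomes the constant term of the quotient.
  divMod : ∀ {g e} → HasDegree g e → ∀ p →
           ∃[ s ] ∃[ r ] p ≋ s * g + r × Below e r
  divMod hg [] = [] , [] , P.refl , λ i _ → R.refl
  divMod {g} {e} hg@(g≉0 , bg) (x ∷ p)
    with s , r , p≋sg+r , br ← divMod {g} hg p
       | g⁻¹ , g⁻¹g≈1 ← inverse g≉0
    = k ∷ s , (x ∷ r) - scale k g , division , below
    where
    k = coeff (x ∷ r) e R.* g⁻¹

    division : x ∷ p ≋ (k ∷ s) * g + ((x ∷ r) - scale k g)
    division = begin
      x ∷ p                              ≈⟨ ∷-cong (R.sym (R.+-identityˡ x)) p≋sg+r ⟩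
      sg + (x ∷ r)                       ≈⟨ P.+-identityˡ _ ⟨
      [] + (sg + (x ∷ r))                ≈⟨ P.+-congʳ (P.-‿inverseʳ kg) ⟨
      (kg - kg) + (sg + (x ∷ r))
        ≈⟨ solve 4 (λ a b c d → (a :+ b) :+ (c :+ d) := (a :+ c) :+ (d :+ b))
             P.refl kg (- kg) sg (x ∷ r) ⟩
      (kg + sg) + ((x ∷ r) - kg)         ∎
      where
      open ≈-Reasoning P.setoid
      open SemiringSolver P.commutativeSemiring
      kg = scale k g
      sg = R.0# ∷ s * g

    coeff-remainder : ∀ i →
      coeff ((x ∷ r) - scale k g) i R.≈ coeff (x ∷ r) i R.- k R.* coeff g i
    coeff-remainder i = R.trans (coeff-+ (x ∷ r) (- scale k g) i)
      (R.+-congˡ (R.trans (coeff-neg (scale k g) i) (R.-‿cong (coeff-scale k g i))))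

    top-cancels : coeff (x ∷ r) e R.≈ k R.* coeff g e
    top-cancels = R.sym (R.trans (R.*-assoc _ _ _)
      (R.trans (R.*-congˡ g⁻¹g≈1) (R.*-identityʳ _)))

    below : Below e ((x ∷ r) - scale k g)
    below i e≤i = R.trans (coeff-remainder i)
      (R.trans (R.+-congʳ (agree i e≤i)) (R.-‿inverseʳ _))
      where
      agree : ∀ i → e ℕ.≤ i → coeff (x ∷ r) i R.≈ k R.* coeff g i
      agree i e≤i with ℕ.m≤n⇒m<n∨m≡n e≤i
      ... | inj₂ ≡.refl        = top-cancels
      ... | inj₁ (s≤s {n = j} e≤j) =
        R.trans (br j e≤j) (R.sym (R.trans (R.*-congˡ (bg (suc j) (s≤s e≤j))) (R.zeroʳ k)))

  -- Euclid's algorithm, structurally recursive in a bound n on the degree of the second argument: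
  -- either the coefficient at n vanishes and the bound drops, or q has degree exactly n and the
  -- remainder lies below n. The factor z goes through each step because z p = s (z q) + z r.
  gcd : ∀ n p q → Below n q → ∃[ g ] IsStrongGCD p q g
  gcd zero p q bq = p , record
    { divides₁ = ∣ʳ-refl
    ; divides₂ = 0# , P.sym (Below-0 {q} bq)
    ; greatest = λ z d∣zp _ → d∣zp
    }
  gcd (suc n) p q bq with coeff q n ≟ R.0#
  ... | yes e = gcd n p q (Below-pred {p = q} bq e)
  ... | no q≉0
    with s , r , p≋sq+r , br ← divMod {q} (q≉0 , bq) p
    with g , isGCD ← gcd n q r br
    = g , record
    { divides₁ = ∣ʳ-respʳ-≈ (P.sym p≋sq+r) (∣-+ (x∣ʳy⇒x∣ʳzy s divides₁) divides₂)
    ; divides₂ = divides₁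
    ; greatest = λ z d∣zp d∣zq →
        greatest z d∣zq (∣-+-cancelˡ (x∣ʳy⇒x∣ʳzy s d∣zq) (∣ʳ-respʳ-≈ (expand z) d∣zp))
    }
    where
    open IsStrongGCD isGCD
    open SemiringSolver P.commutativeSemiring
    expand : ∀ z → z * p ≋ s * (z * q) + z * r
    expand z = P.trans (P.*-congˡ {z} p≋sq+r)
      (solve 4 (λ z s q r → z :* (s :* q :+ r) := s :* (z :* q) :+ z :* r) P.refl z s q r)

  -- The case z = 1. The helpers `to` and `from` convert between divisibility over `_≋_` and over
  -- the unwrapped `_≈ₚ_`.
  IsStrongGCD⇒IsGCD : ∀ {p q g} → IsStrongGCD p q g → IsGCD p q g
  IsStrongGCD⇒IsGCD {p} {q} {g} isGCD = record
    { divides₁ = to divides₁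
    ; divides₂ = to divides₂
    ; greatest = λ h∣p h∣q → to (∣ʳ-respʳ-≈ (P.*-identityˡ g)
        (greatest 1# (x∣ʳy⇒x∣ʳzy 1# (from h∣p)) (x∣ʳy⇒x∣ʳzy 1# (from h∣q))))
    }
    where
    open IsStrongGCD isGCD
    to : ∀ {h r} → h ∣ᴾ r → h ∣ r
    to h∣r = record { quotient = quotient ; equality = at equality }
      where open RawMagmaDefinitions._∣ʳ_ h∣r
    from : ∀ {h r} → h ∣ r → h ∣ᴾ r
    from h∣r = record { quotient = quotient ; equality = pointwise equality }
      where open RawMagmaDefinitions._∣ʳ_ h∣r

  -- Roots: a polynomial with more roots than its degree is zero.

  module EvalAt = Evaluation R R (Identity.isRingHomomorphism R.rawRing R.refl)
  open EvalAt using (eval)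

  -- The Ruffini-Horner quotient of p by T - c: its coefficients are the values at c of the
  -- successive tails of p.
  syntheticDiv : R.Carrier → Poly → Poly
  syntheticDiv c []      = []
  syntheticDiv c (x ∷ p) = eval c p ∷ syntheticDiv c p

  -- p(y) - p(c) = (y - c) s(y), with no subtraction.
  eval-syntheticDiv : ∀ c y p → let s = eval y (syntheticDiv c p) in
    eval y p R.+ c R.* s R.≈ y R.* s R.+ eval c p
  eval-syntheticDiv c y [] =
    solve 2 (λ c y → con 0 :+ c :* con 0 := y :* con 0 :+ con 0) R.refl c y
    where open SemiringSolver R.commutativeSemiring
  eval-syntheticDiv c y (x ∷ p) = begin
    x R.+ y R.* py R.+ c R.* (pc R.+ y R.* s)
      ≈⟨ solve 6 (λ x y c py pc s → x :+ y :* py :+ c :* (pc :+ y :* s)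
           := (x :+ c :* pc) :+ y :* (py :+ c :* s)) R.refl x y c py pc s ⟩
    x R.+ c R.* pc R.+ y R.* (py R.+ c R.* s)
      ≈⟨ R.+-congˡ (R.*-congˡ (eval-syntheticDiv c y p)) ⟩
    x R.+ c R.* pc R.+ y R.* (y R.* s R.+ pc)
      ≈⟨ solve 5 (λ x y c pc s → x :+ c :* pc :+ y :* (y :* s :+ pc)
           := y :* (pc :+ y :* s) :+ (x :+ c :* pc)) R.refl x y c pc s ⟩
    y R.* (pc R.+ y R.* s) R.+ (x R.+ c R.* pc) ∎
    where
    open ≈-Reasoning R.setoid
    open SemiringSolver R.commutativeSemiring
    py = eval y p
    pc = eval c p
    s  = eval y (syntheticDiv c p)

  Below-syntheticDiv : ∀ {n} c p → Below (suc n) p → Below n (syntheticDiv c p)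
  Below-syntheticDiv c []      bp i       n≤i = R.refl
  Below-syntheticDiv {zero} c (x ∷ p) bp zero    n≤i =
    EvalAt.eval-≋[] c (Below-0 {p} λ i _ → bp (suc i) (s≤s z≤n))
  Below-syntheticDiv {zero} c (x ∷ p) bp (suc i) n≤i =
    Below-syntheticDiv {zero} c p (λ j _ → bp (suc j) (s≤s z≤n)) i z≤n
  Below-syntheticDiv {suc n} c (x ∷ p) bp (suc i) (s≤s n≤i) =
    Below-syntheticDiv c p (λ j n<j → bp (suc j) (s≤s n<j)) i n≤i

  -- The head of the quotient of x + T p is p(c), and its tail is the quotient of p. Both vanish, so
  -- p = 0 by induction, and x = x + c p(c) = 0.
  syntheticDiv-≋[] : ∀ c p → syntheticDiv c p ≋ [] → eval c p R.≈ R.0# → p ≋ []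
  syntheticDiv-≋[] c []      e pc≈0 = P.refl
  syntheticDiv-≋[] c (x ∷ p) e pc≈0 =
    ∷-≋[] (begin
      x                    ≈⟨ R.+-identityʳ x ⟨
      x R.+ R.0#           ≈⟨ R.+-congˡ (R.trans (R.*-congˡ (head-≋[] e)) (R.zeroʳ c)) ⟨
      x R.+ c R.* eval c p ≈⟨ pc≈0 ⟩
      R.0#                 ∎)
      (syntheticDiv-≋[] c p (tail-≋[] e) (head-≋[] e))
    where open ≈-Reasoning R.setoid

  -- Dividing by T - r₀ lowers the degree bound by one. The quotient s still vanishes at every other
  -- rᵢ, because r₀ s(rᵢ) = rᵢ s(rᵢ) with s(rᵢ) ≠ 0 would force rᵢ = r₀.
  vanishing : ∀ {n} (r : Vector R.Carrier n) → (∀ {i j} → r i R.≈ r j → i ≡ j) →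
              ∀ p → Below n p → (∀ i → eval (r i) p R.≈ R.0#) → p ≋ []
  vanishing {zero}  r inj p bp p≈0 = Below-0 {p} bp
  vanishing {suc n} r inj p bp p≈0 =
    syntheticDiv-≋[] r₀ p
      (vanishing (r ∘ suc) (Fin.suc-injective ∘ inj) s (Below-syntheticDiv r₀ p bp) s≈0)
      (p≈0 zero)
    where
    r₀ = r zero
    s  = syntheticDiv r₀ p

    s≈0 : ∀ i → eval (r (suc i)) s R.≈ R.0#
    s≈0 i with eval (r (suc i)) s ≟ R.0#
    ... | yes e  = e
    ... | no s≉0 = contradiction (inj (*-cancelˡ-≉0 s≉0 (begin
      sᵢ R.* r₀                    ≈⟨ R.*-comm _ _ ⟩
      r₀ R.* sᵢ                    ≈⟨ R.+-identityˡ _ ⟨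
      R.0# R.+ r₀ R.* sᵢ           ≈⟨ R.+-congʳ (p≈0 (suc i)) ⟨
      eval rᵢ p R.+ r₀ R.* sᵢ      ≈⟨ eval-syntheticDiv r₀ rᵢ p ⟩
      rᵢ R.* sᵢ R.+ eval r₀ p      ≈⟨ R.+-congˡ (p≈0 zero) ⟩
      rᵢ R.* sᵢ R.+ R.0#           ≈⟨ R.+-identityʳ _ ⟩
      rᵢ R.* sᵢ                    ≈⟨ R.*-comm _ _ ⟩
      sᵢ R.* rᵢ                    ∎))) λ ()
      where
      open ≈-Reasoning R.setoid
      rᵢ = r (suc i)
      sᵢ = eval rᵢ s

-- Finite fields: decidable equality, inverses, and the identity x^q = x.

module FiniteField {c ℓ₁ ℓ₂} (F : HeytingField c ℓ₁ ℓ₂)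
  (q-1 : ℕ) (card : Field.HasCardinality F (suc q-1)) where

  private
    q = suc q-1
    module F = HeytingField F
    module R = CommutativeRing
      (HeytingCommutativeRing.commutativeRing F.heytingCommutativeRing)
    R = HeytingCommutativeRing.commutativeRing F.heytingCommutativeRing

  open Inverse card using (to; to-cong; from; inverseˡ; inverseʳ)

  from-to : ∀ x → from (to x) R.≈ x
  from-to x = inverseʳ ≡.refl

  from-injective : ∀ {i j} → from i R.≈ from j → i ≡ j
  from-injective e = ≡.trans (≡.sym (inverseˡ R.refl)) (inverseˡ e)

  _≟_ : Decidable R._≈_
  x ≟ y = map′ (λ e → R.trans (R.sym (from-to x)) (inverseʳ e)) to-cong (to x Fin.≟ to y)

  -- The field axioms invert elements apart from 0, while here x is only known to be unequal to 0. A
  -- search over all q elements bridges the gap: if it finds no inverse, x is not apart from 0, and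
  -- tightness gives x = 0.
  inverse : HasInverses R
  inverse {x} x≉0 with Fin.any? (λ i → (from i R.* x) ≟ R.1#)
  ... | yes (i , e) = from i , e
  ... | no ¬inv     = contradiction (proj₁ (F.tight x R.0#) ¬x#0) x≉0
    where
    open HeytingCommutativeRingProperties F.heytingCommutativeRing using (x-0≈x)
    ¬x#0 : ¬ x F.# R.0#
    ¬x#0 x#0 with y , y[x-0]≈1 , _ ← F.#⇒invertible x#0 =
      ¬inv (to y , R.trans (R.*-cong (from-to y) (R.sym (x-0≈x x))) y[x-0]≈1)

  open DiscreteField R _≟_ inverse public
  open Exp R.commutativeSemiring using (_^_)
  open Sum R.*-commutativeMonoid using ()
    renaming (sum to ∏; sum-remove to ∏-remove; sum-cong-≋ to ∏-cong;
              sum-permute to ∏-permute; ∑-distrib-+ to ∏-distrib-*; sum-replicate to ∏-replicate)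

  1≉0 : ¬ R.1# R.≈ R.0#
  1≉0 1≈0 = F.#-irrefl 1≈0
    (HeytingCommutativeRingProperties.1#0 F.heytingCommutativeRing)

  ∏-≉0 : ∀ {n} (f : Vector R.Carrier n) → (∀ i → ¬ f i R.≈ R.0#) → ¬ ∏ f R.≈ R.0#
  ∏-≉0 {zero}  f f≉0 = 1≉0
  ∏-≉0 {suc n} f f≉0 = *-≉0 (f≉0 zero) (∏-≉0 (f ∘ suc) (f≉0 ∘ suc))

  -- Multiplication by x permutes the nonzero elements. To take the product over
  -- all of Fin q, unit replaces 0 by 1, and factor is the ratio unit(xy)/unit(y).
  x^q≈x : ∀ x → x ^ q R.≈ x
  x^q≈x x with x ≟ R.0#
  ... | yes x≈0 = R.trans (R.*-congʳ x≈0) (R.trans (R.zeroˡ _) (R.sym x≈0))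
  ... | no x≉0 with x⁻¹ , x⁻¹x≈1 ← inverse x≉0 = begin
    x R.* x ^ q-1 ≈⟨ R.*-congˡ x^[q-1]≈1 ⟩
    x R.* R.1#    ≈⟨ R.*-identityʳ x ⟩
    x             ∎
    where
    open ≈-Reasoning R.setoid

    select : R.Carrier → R.Carrier → R.Carrier
    select z y with y ≟ R.0#
    ... | yes _ = R.1#
    ... | no  _ = z

    select-0 : ∀ {z y} → y R.≈ R.0# → select z y R.≈ R.1#
    select-0 {z} {y} y≈0 with y ≟ R.0#
    ... | yes _   = R.refl
    ... | no  y≉0 = contradiction y≈0 y≉0

    select-≉0 : ∀ {z y} → ¬ y R.≈ R.0# → select z y R.≈ z
    select-≉0 {z} {y} y≉0 with y ≟ R.0#
    ... | yes y≈0 = contradiction y≈0 y≉0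
    ... | no  _   = R.refl

    unit : R.Carrier → R.Carrier
    unit y = select y y

    factor : R.Carrier → R.Carrier
    factor = select x

    unit-cong : ∀ {y z} → y R.≈ z → unit y R.≈ unit z
    unit-cong {y} {z} e with y ≟ R.0#
    ... | yes y≈0 = R.sym (select-0 (R.trans (R.sym e) y≈0))
    ... | no  y≉0 = R.trans e (R.sym (select-≉0 (y≉0 ∘ R.trans e)))

    unit-≉0 : ∀ y → ¬ unit y R.≈ R.0#
    unit-≉0 y with y ≟ R.0#
    ... | yes _   = 1≉0
    ... | no  y≉0 = y≉0

    unit-* : ∀ y → unit (x R.* y) R.≈ factor y R.* unit y
    unit-* y with y ≟ R.0#
    ... | yes y≈0 =
      R.trans (select-0 (R.trans (R.*-congˡ y≈0) (R.zeroʳ x))) (R.sym (R.*-identityˡ _))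
    ... | no  y≉0 = select-≉0 (*-≉0 x≉0 y≉0)

    mul-cancel : ∀ {y z} → y R.* z R.≈ R.1# → ∀ i → to (y R.* from (to (z R.* from i))) ≡ i
    mul-cancel {y} {z} yz≈1 i = inverseˡ (begin
      y R.* from (to (z R.* from i)) ≈⟨ R.*-congˡ (from-to _) ⟩
      y R.* (z R.* from i)           ≈⟨ R.*-assoc _ _ _ ⟨
      y R.* z R.* from i             ≈⟨ R.*-congʳ yz≈1 ⟩
      R.1# R.* from i                ≈⟨ R.*-identityˡ _ ⟩
      from i                         ∎)

    π : Permutation′ q
    π = permutation (λ i → to (x R.* from i)) (λ i → to (x⁻¹ R.* from i))
      (mul-cancel (R.trans (R.*-comm _ _) x⁻¹x≈1)) (mul-cancel x⁻¹x≈1)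

    i₀ : Fin q
    i₀ = to R.0#

    -- Splitting off the index of 0, where `factor` is 1, leaves q - 1 factors equal to x.
    ∏factor : ∏ (factor ∘ from) R.≈ x ^ q-1
    ∏factor = begin
      ∏ (factor ∘ from)
        ≈⟨ ∏-remove {i = i₀} (factor ∘ from) ⟩
      factor (from i₀) R.* ∏ (removeAt (factor ∘ from) i₀)
        ≈⟨ R.*-cong (select-0 (from-to R.0#))
             (∏-cong λ j → select-≉0 λ e → Fin.punchInᵢ≢i i₀ j
               (from-injective (R.trans e (R.sym (from-to R.0#))))) ⟩
      R.1# R.* ∏ (replicate q-1 x)
        ≈⟨ R.*-identityˡ _ ⟩
      ∏ (replicate q-1 x)
        ≈⟨ ∏-replicate q-1 ⟩
      x ^ q-1 ∎

    x^[q-1]≈1 : x ^ q-1 R.≈ R.1#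
    -- Reindexing by `π` shows that the product of all `unit` values equals itself times x^(q-1);
    -- being nonzero, it cancels.
    x^[q-1]≈1 = *-cancelˡ-≉0 (∏-≉0 (unit ∘ from) (unit-≉0 ∘ from)) (begin
      ∏ (unit ∘ from) R.* x ^ q-1
        ≈⟨ R.*-comm _ _ ⟩
      x ^ q-1 R.* ∏ (unit ∘ from)
        ≈⟨ R.*-congʳ ∏factor ⟨
      ∏ (factor ∘ from) R.* ∏ (unit ∘ from)
        ≈⟨ ∏-distrib-* (factor ∘ from) (unit ∘ from) ⟨
      ∏ (λ i → factor (from i) R.* unit (from i))
        ≈⟨ ∏-cong (λ i → R.trans (unit-cong (from-to _)) (unit-* (from i))) ⟨
      ∏ (λ i → unit (from (to (x R.* from i))))
        ≈⟨ ∏-permute (unit ∘ from) π ⟨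
      ∏ (unit ∘ from)
        ≈⟨ R.*-identityʳ _ ⟨
      ∏ (unit ∘ from) R.* R.1# ∎)

-- The Frobenius identity and the degree of the gcd.

module Frobenius {c ℓ₁ ℓ₂} (F : HeytingField c ℓ₁ ℓ₂)
  (q-1 : ℕ) (card : Field.HasCardinality F (suc q-1)) where

  private
    q = suc q-1
    R = HeytingCommutativeRing.commutativeRing (HeytingField.heytingCommutativeRing F)
    module R = CommutativeRing R

  open FiniteField F q-1 card
  open Field F using (Poly; coeff; HasDegree; _+_; _*_; _-_; -_; 0#; 1#)
  open PolynomialRing R
  open PolynomialDegree R
  open Exp P.commutativeSemiring using (^-congˡ; ^-assocʳ; ^-distrib-*)
  module R^ = Exp R.commutativeSemiring
  open RingProperties P.ring using (x[y-z]≈xy-xz; xyx⁻¹≈y; x∙y⁻¹≈ε⇒x≈y)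
  open RingProperties R.ring using (+-identityˡ-unique; -0#≈0#)
  open RingDivisibility polyCommutativeRing
    using (IsStrongGCD; _,_; ∣ʳ-trans; ∣ʳ-respʳ-≈; ∣ʳ-respˡ-≈; x∣ʳy⇒x∣ʳzy; 0∣x⇒x≈0; x-1∣x^n-1)
    renaming (_∣_ to _∣ᴾ_)
  open CommutativeSemigroupProperties P.*-commutativeSemigroup using (xy∙z≈y∙xz)
  open CommutativeDivisibility P.*-commutativeSemigroup using (x∣y⇒zx∣zy)

  2≤q : 2 ℕ.≤ q
  2≤q = distinct⇒2≤ q-1 λ e → 1≉0 (R.trans (R.sym (from-to R.1#)) (Inverse.inverseʳ card e))
    where
    distinct⇒2≤ : ∀ n {i j : Fin (suc n)} → i ≢ j → 2 ℕ.≤ suc n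
    distinct⇒2≤ zero {zero} {zero} i≢j = contradiction ≡.refl i≢j
    distinct⇒2≤ (suc n) _ = s≤s (s≤s z≤n)

  Below-const+X : ∀ c → Below 2 (c ∷ R.1# ∷ [])
  Below-const+X c (suc (suc i)) _ = R.refl
  Below-const+X c (suc zero) (s≤s ())

  Below-[const+X]^ : ∀ c n → Below (suc n) ((c ∷ R.1# ∷ []) ^ᴾ n)
  Below-[const+X]^ c n = ≡.subst (λ d → Below (suc d) ((c ∷ R.1# ∷ []) ^ᴾ n)) (ℕ.*-identityʳ n)
    (Below-^ (c ∷ R.1# ∷ []) n (Below-const+X c))

  coeff-[const+X]^ : ∀ c n → coeff ((c ∷ R.1# ∷ []) ^ᴾ n) n R.≈ R.1#
  coeff-[const+X]^ c n = ≡.subst (λ d → coeff ((c ∷ R.1# ∷ []) ^ᴾ n) d R.≈ R.1#) (ℕ.*-identityʳ n)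
    (coeff-^-top (c ∷ R.1# ∷ []) n (Below-const+X c) R.refl)

  coeff-- : ∀ p r i → coeff (p - r) i R.≈ coeff p i R.- coeff r i
  coeff-- p r i = R.trans (coeff-+ p (- r) i) (R.+-congˡ (coeff-neg r i))

  eval-[const+X]^q : ∀ c d →
    EvalAt.eval d ((c ∷ R.1# ∷ []) ^ᴾ q) R.≈ EvalAt.eval d (const c + X ^ᴾ q)
  eval-[const+X]^q c d = begin
    eval ((c ∷ R.1# ∷ []) ^ᴾ q)       ≈⟨ eval-^ (c ∷ R.1# ∷ []) q ⟩
    eval (c ∷ R.1# ∷ []) R^.^ q       ≈⟨ x^q≈x _ ⟩
    eval (c ∷ R.1# ∷ [])              ≈⟨ eval-const+X c ⟩
    c R.+ d                           ≈⟨ R.+-congˡ (R.+-identityˡ d) ⟨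
    c R.+ (R.0# R.+ d)                ≈⟨ R.+-cong (eval-const c) (eval-const+X R.0#) ⟨
    eval (const c) R.+ eval X         ≈⟨ R.+-congˡ (x^q≈x (eval X)) ⟨
    eval (const c) R.+ eval X R^.^ q  ≈⟨ R.+-congˡ (eval-^ X q) ⟨
    eval (const c) R.+ eval (X ^ᴾ q)  ≈⟨ eval-+ (const c) (X ^ᴾ q) ⟨
    eval (const c + X ^ᴾ q)           ∎
    where
    open ≈-Reasoning R.setoid
    open EvalAt d

  [const+X]^q : ∀ c → (c ∷ R.1# ∷ []) ^ᴾ q ≋ const c + X ^ᴾ q
  [const+X]^q c = begin
    A      ≈⟨ A≋h+B ⟩
    h + B  ≈⟨ P.+-congʳ (vanishing from from-injective h below (λ i → root (from i))) ⟩
    B      ∎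
    where
    open ≈-Reasoning P.setoid
    open Inverse card using (from)
    A = (c ∷ R.1# ∷ []) ^ᴾ q
    B = const c + X ^ᴾ q
    h = A - B

    A≋h+B : A ≋ h + B
    A≋h+B = P.sym (P.trans (P.+-assoc A (- B) B)
      (P.trans (P.+-congˡ {A} (P.-‿inverseˡ B)) (P.+-identityʳ A)))

    coeff-B : ∀ i → coeff B (suc i) R.≈ coeff (X ^ᴾ q) (suc i)
    coeff-B i = R.trans (coeff-+ (const c) (X ^ᴾ q) (suc i)) (R.+-identityˡ _)

    -- At index q both sides have coefficient 1: q is positive, so the constant c does not reach it.
    agree : ∀ i → q ℕ.≤ i → coeff A i R.≈ coeff B i
    agree i q≤i with ℕ.m≤n⇒m<n∨m≡n q≤i
    ... | inj₂ ≡.refl = R.trans (coeff-[const+X]^ c q)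
      (R.sym (R.trans (coeff-B q-1) (coeff-[const+X]^ R.0# q)))
    ... | inj₁ q<i@(s≤s {n = j} _) = R.trans (Below-[const+X]^ c q i q<i)
      (R.sym (R.trans (coeff-B j) (Below-[const+X]^ R.0# q i q<i)))

    below : Below q h
    below i q≤i = R.trans (coeff-- A B i)
      (R.trans (R.+-congʳ (agree i q≤i)) (R.-‿inverseʳ _))

    root : ∀ d → EvalAt.eval d h R.≈ R.0#
    root d = +-identityˡ-unique (eval h) (eval B)
      (R.trans (R.sym (eval-+ h B))
        (R.trans (eval-cong (P.sym A≋h+B)) (eval-[const+X]^q c d)))
      where open EvalAt d

  -- Counting roots only concerns elements of F, but it yields an identity of polynomials in T, and
  -- there g can be substituted for T. Additivity for a constant plus g is enough, since Horner's
  -- form adds one constant at a time.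
  [const+g]^q : ∀ c g → (const c + g) ^ᴾ q ≋ const c + g ^ᴾ q
  [const+g]^q c g = begin
    (const c + g) ^ᴾ q          ≈⟨ ^-congˡ q (eval-const+X c) ⟨
    eval (c ∷ R.1# ∷ []) ^ᴾ q   ≈⟨ eval-^ (c ∷ R.1# ∷ []) q ⟨
    eval ((c ∷ R.1# ∷ []) ^ᴾ q) ≈⟨ eval-cong ([const+X]^q c) ⟩
    eval (const c + X ^ᴾ q)     ≈⟨ eval-+ (const c) (X ^ᴾ q) ⟩
    eval (const c) + eval (X ^ᴾ q) ≈⟨ P.+-cong (eval-const c) (eval-^ X q) ⟩
    const c + eval X ^ᴾ q
      ≈⟨ P.+-congˡ {const c} (^-congˡ q (eval-const+X R.0#)) ⟩
    const c + (const R.0# + g) ^ᴾ q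
      ≈⟨ P.+-congˡ {const c} (^-congˡ q (P.+-congʳ {g} (∷-≋[] R.refl P.refl))) ⟩
    const c + g ^ᴾ q            ∎
    where
    open ≈-Reasoning P.setoid
    open Evaluation R polyCommutativeRing const-isRingHomomorphism g

  -- Each application of `[const+g]^q` leaves c fixed and turns g into g^q, so the induction is on e
  -- with g general.
  [const+g]^q^e : ∀ e c g → (const c + g) ^ᴾ (q ℕ.^ e) ≋ const c + g ^ᴾ (q ℕ.^ e)
  [const+g]^q^e zero c g =
    P.trans (P.*-identityʳ (const c + g)) (P.+-congˡ {const c} (P.sym (P.*-identityʳ g)))
  [const+g]^q^e (suc e) c g = begin
    (const c + g) ^ᴾ (q ℕ.* q ℕ.^ e)      ≈⟨ ^-assocʳ (const c + g) q (q ℕ.^ e) ⟨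
    ((const c + g) ^ᴾ q) ^ᴾ (q ℕ.^ e)     ≈⟨ ^-congˡ (q ℕ.^ e) ([const+g]^q c g) ⟩
    (const c + g ^ᴾ q) ^ᴾ (q ℕ.^ e)       ≈⟨ [const+g]^q^e e c (g ^ᴾ q) ⟩
    const c + (g ^ᴾ q) ^ᴾ (q ℕ.^ e)       ≈⟨ P.+-congˡ {const c} (^-assocʳ g q (q ℕ.^ e)) ⟩
    const c + g ^ᴾ (q ℕ.* q ℕ.^ e)        ∎
    where open ≈-Reasoning P.setoid

  -- With Q written as `suc Q-1`, `f ^ᴾ Q` unfolds to `f * f ^ᴾ Q-1`, which exposes the factor f of
  -- f^Q - f.
  module _ (e : ℕ) {Q-1 : ℕ} (q^e≡Q : q ℕ.^ e ≡ suc Q-1) (2≤Q : 2 ℕ.≤ suc Q-1) where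

    private
      Q = suc Q-1

    D : Poly
    D = X ^ᴾ Q - X

    [const+g]^Q : ∀ c g → (const c + g) ^ᴾ Q ≋ const c + g ^ᴾ Q
    [const+g]^Q = ≡.subst (λ n → ∀ c g → (const c + g) ^ᴾ n ≋ const c + g ^ᴾ n)
      q^e≡Q ([const+g]^q^e e)

    -- Induction on the coefficients: (c + T f)^Q = c + T^Q f^Q with T^Q = D + T. Replacing T^Q
    -- contributes f^Q to the cofactor of D, and the induction hypothesis for f contributes T t.
    f^Q≋f+tD : ∀ f → ∃[ t ] f ^ᴾ Q ≋ f + t * D
    f^Q≋f+tD []      = [] , P.refl
    f^Q≋f+tD (c ∷ f) with t , f^Q≋f+tD′ ← f^Q≋f+tD f = f ^ᴾ Q + X * t , (begin
      (c ∷ f) ^ᴾ Q               ≈⟨ ^-congˡ Q (∷-≋-const+X* c f) ⟩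
      (const c + X * f) ^ᴾ Q     ≈⟨ [const+g]^Q c (X * f) ⟩
      const c + (X * f) ^ᴾ Q     ≈⟨ P.+-congˡ {const c} (^-distrib-* X f Q) ⟩
      const c + X ^ᴾ Q * f ^ᴾ Q  ≈⟨ P.+-congˡ {const c} (P.*-congʳ {f ^ᴾ Q} X^Q≋D+X) ⟩
      const c + (D + X) * f ^ᴾ Q
        ≈⟨ P.+-congˡ {const c} (P.distribʳ (f ^ᴾ Q) D X) ⟩
      const c + (D * f ^ᴾ Q + X * f ^ᴾ Q)
        ≈⟨ P.+-congˡ {const c} (P.+-congˡ {D * f ^ᴾ Q} (P.*-congˡ {X} f^Q≋f+tD′)) ⟩
      const c + (D * f ^ᴾ Q + X * (f + t * D))
        ≈⟨ solve 6 (λ c d g x f t → c :+ (d :* g :+ x :* (f :+ t :* d))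
             := (c :+ x :* f) :+ (g :+ x :* t) :* d)
             P.refl (const c) D (f ^ᴾ Q) X f t ⟩
      (const c + X * f) + (f ^ᴾ Q + X * t) * D
        ≈⟨ P.+-congʳ {(f ^ᴾ Q + X * t) * D} (∷-≋-const+X* c f) ⟨
      (c ∷ f) + (f ^ᴾ Q + X * t) * D ∎)
      where
      open ≈-Reasoning P.setoid
      open SemiringSolver P.commutativeSemiring
      X^Q≋D+X : X ^ᴾ Q ≋ D + X
      X^Q≋D+X = P.sym (P.trans (P.+-assoc (X ^ᴾ Q) (- X) X)
        (P.trans (P.+-congˡ {X ^ᴾ Q} (P.-‿inverseˡ X)) (P.+-identityʳ _)))

    D∣f[f^n-1] : ∀ m f → D ∣ᴾ f * (f ^ᴾ (Q-1 ℕ.* m) - 1#)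
    D∣f[f^n-1] m f = ∣ʳ-trans D∣f[f^[Q-1]-1]
      (x∣y⇒zx∣zy f (∣ʳ-respʳ-≈ (P.+-congʳ (^-assocʳ f Q-1 m)) (x-1∣x^n-1 (f ^ᴾ Q-1) m)))
      where
      open ≈-Reasoning P.setoid
      D∣f[f^[Q-1]-1] : D ∣ᴾ f * (f ^ᴾ Q-1 - 1#)
      D∣f[f^[Q-1]-1] with t , f^Q≋f+tD′ ← f^Q≋f+tD f = t , (begin
        t * D                   ≈⟨ xyx⁻¹≈y f (t * D) ⟨
        f + t * D - f           ≈⟨ P.+-cong (P.sym f^Q≋f+tD′) (P.-‿cong (P.sym (P.*-identityʳ f))) ⟩
        f * f ^ᴾ Q-1 - f * 1#   ≈⟨ x[y-z]≈xy-xz f (f ^ᴾ Q-1) 1# ⟨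
        f * (f ^ᴾ Q-1 - 1#)     ∎)

    -- As Q is at least 2, subtracting `X` does not affect the coefficients from index Q on.
    HasDegree-D : HasDegree D Q
    HasDegree-D = (λ e → 1≉0 (R.trans (R.sym top) e)) , λ i Q<i →
      R.trans (coeff-- (X ^ᴾ Q) X i) (R.trans
        (R.+-cong (Below-[const+X]^ R.0# Q i Q<i)
          (R.-‿cong (Below-const+X R.0# i (ℕ.≤-trans 2≤Q (ℕ.<⇒≤ Q<i)))))
        (R.-‿inverseʳ _))
      where
      top : coeff D Q R.≈ R.1#
      top = R.trans (coeff-- (X ^ᴾ Q) X Q) (R.trans
        (R.+-cong (coeff-[const+X]^ R.0# Q) (R.trans (R.-‿cong (Below-const+X R.0# Q 2≤Q)) -0#≈0#))
        (R.+-identityʳ _))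

    -- Otherwise f^n, of degree n d > 0, would equal 1. This excludes a zero gcd, which would have
    -- no degree.
    f^n-1≉0 : ∀ {f d n} → 0 ℕ.< d → HasDegree f d → 0 ℕ.< n → ¬ f ^ᴾ n - 1# ≋ 0#
    f^n-1≉0 {f} {d@(suc _)} {n@(suc _)} 0<d hf 0<n e =
      contradiction (HasDegree-unique {f ^ᴾ n} {1#} f^n≋1 (HasDegree-^ {f} hf n) HasDegree-1) λ ()
      where
      HasDegree-1 : HasDegree 1# 0
      HasDegree-1 = 1≉0 , λ { (suc i) _ → R.refl }
      f^n≋1 : f ^ᴾ n ≋ 1#
      f^n≋1 = x∙y⁻¹≈ε⇒x≈y (f ^ᴾ n) 1# e

    -- Compares degrees in s D = a b g. The right side is nonzero, hence so is s, and Q is at most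
    -- deg s + Q = da + db + d.
    gcd-degree : ∀ {a b da db} → 0 ℕ.< da → HasDegree a da → HasDegree b db →
      ∀ m → let n = Q-1 ℕ.* m in 0 ℕ.< n →
      ∀ {g} → IsStrongGCD (a ^ᴾ n - 1#) (b ^ᴾ n - 1#) g →
      ∃[ d ] HasDegree g d × Q ℕ.≤ da ℕ.+ db ℕ.+ d
    gcd-degree {a} {b} {da} {db} 0<da ha hb m 0<n {g} isGCD with degree? g
    ... | inj₁ g≋0 = contradiction (0∣x⇒x≈0 (∣ʳ-respˡ-≈ g≋0 divides₁)) (f^n-1≉0 {a} 0<da ha 0<n)
      where open IsStrongGCD isGCD
    ... | inj₂ (d , hg) with D∣abg
      where
      open IsStrongGCD isGCD
      D∣abg : D ∣ᴾ (a * b) * g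
      -- The factor a serves the divisibility for a^n - 1 and b the one for b^n - 1; their product
      -- serves both.
      D∣abg = greatest (a * b)
        (∣ʳ-respʳ-≈ (P.sym (xy∙z≈y∙xz a b _)) (x∣ʳy⇒x∣ʳzy b (D∣f[f^n-1] m a)))
        (∣ʳ-respʳ-≈ (P.sym (P.*-assoc a b _)) (x∣ʳy⇒x∣ʳzy a (D∣f[f^n-1] m b)))
    ... | s , sD≋abg with degree? s
    ...   | inj₁ s≋0 = contradiction
      (P.trans (P.sym sD≋abg) (P.trans (P.*-congʳ {D} s≋0) (P.zeroˡ D)))
      λ abg≋0 → proj₁ habg (at abg≋0 _)
      where habg = HasDegree-* {a * b} {g} (HasDegree-* {a} {b} ha hb) hg
    ...   | inj₂ (e , hs) = d , hg , ℕ.≤-trans (ℕ.m≤n+m Q e) (ℕ.≤-reflexive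
      (HasDegree-unique {s * D} {(a * b) * g} sD≋abg (HasDegree-* {s} {D} hs HasDegree-D)
        (HasDegree-* {a * b} {g} (HasDegree-* {a} {b} ha hb) hg)))

-- Arithmetic of the exponents and of the constant.

-- In the unnormalised rationals no fraction is reduced to lowest terms, and the claim is a
-- cross-multiplication.
1/K*n≤d : ∀ {K n d} .{{_ : ℕ.NonZero K}} → n ℕ.≤ K ℕ.* d →
          (+ 1 / K) ℚ.* (+ n / 1) ℚ.≤ + d / 1
1/K*n≤d {K@(suc K-1)} {n} {d} n≤Kd = ℚ.toℚᵘ-cancel-≤ (begin
  ℚ.toℚᵘ ((+ 1 / K) ℚ.* (+ n / 1))             ≃⟨ ℚ.toℚᵘ-homo-* (+ 1 / K) (+ n / 1) ⟩
  ℚ.toℚᵘ (+ 1 / K) ℚᵘ.* ℚ.toℚᵘ (+ n / 1)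
    ≃⟨ ℚᵘ.*-cong (ℚ.toℚᵘ-fromℚᵘ (mkℚᵘ (+ 1) K-1)) (ℚ.toℚᵘ-fromℚᵘ (mkℚᵘ (+ n) 0)) ⟩
  mkℚᵘ (+ 1) K-1 ℚᵘ.* mkℚᵘ (+ n) 0             ≤⟨ *≤* cross ⟩
  mkℚᵘ (+ d) 0                                 ≃⟨ ℚ.toℚᵘ-fromℚᵘ (mkℚᵘ (+ d) 0) ⟨
  ℚ.toℚᵘ (+ d / 1)                             ∎)
  where
  open ℚᵘ.≤-Reasoning
  cross : (+ 1 ℤ.* + n) ℤ.* + 1 ℤ.≤ + d ℤ.* (+ (K ℕ.* 1))
  cross = ≡.subst₂ ℤ._≤_
    (≡.sym (≡.trans (ℤ.*-identityʳ _) (ℤ.*-identityˡ (+ n))))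
    (≡.trans
      (≡.cong +_ (≡.trans (ℕ.*-comm K d) (≡.cong (d ℕ.*_) (≡.sym (ℕ.*-identityʳ K)))))
      (ℤ.pos-* d (K ℕ.* 1)))
    (ℤ.+≤+ n≤Kd)

n<m^n : ∀ {m} n → 2 ℕ.≤ m → n ℕ.< m ℕ.^ n
n<m^n zero    2≤m = s≤s z≤n
n<m^n {m} (suc n) 2≤m = begin-strict
  suc n                   ≤⟨ n<m^n n 2≤m ⟩
  m ℕ.^ n                 <⟨ ℕ.m<m+n _ (ℕ.≤-trans (s≤s z≤n) (n<m^n n 2≤m)) ⟩
  m ℕ.^ n ℕ.+ m ℕ.^ n     ≡⟨ ≡.cong (m ℕ.^ n ℕ.+_) (ℕ.+-identityʳ _) ⟨
  2 ℕ.* m ℕ.^ n           ≤⟨ ℕ.*-monoˡ-≤ (m ℕ.^ n) 2≤m ⟩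
  m ℕ.* m ℕ.^ n           ∎
  where open ℕ.≤-Reasoning

-- Modulo K, which divides Q, the number (Q - 1) m is -m, and this is the residue r of n₀ since r +
-- m = K. With n₀ = r + t K the difference is Q m - (r + m) - t K, whence the quotient w m - 1 - t.
[Q-1]m≡n₀ : ∀ {K w Q-1 m} n₀ .{{_ : ℕ.NonZero K}} →
  suc Q-1 ≡ K ℕ.* w → n₀ ℤ.%ℕ K ℕ.+ m ≡ K →
  + K ℤ.∣ + (Q-1 ℕ.* m) ℤ.- n₀
[Q-1]m≡n₀ {K} {w} {Q-1} {m} n₀ Q≡Kw r+m≡K =
  Signed.∣⇒∣ᵤ (Signed.divides (+ w ℤ.* + m ℤ.- + 1 ℤ.- t) (begin
  + n ℤ.- n₀
    ≡⟨ ≡.cong (λ x → + n ℤ.- x) (ℤ.a≡a%ℕn+[a/ℕn]*n n₀ K) ⟩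
  + n ℤ.- (+ r ℤ.+ t ℤ.* + K)
    ≡⟨ solve 5 (λ n m r t K → n :- (r :+ t :* K) := (m :+ n) :- (r :+ m) :- t :* K)
         ≡.refl (+ n) (+ m) (+ r) t (+ K) ⟩
  (+ m ℤ.+ + n) ℤ.- (+ r ℤ.+ + m) ℤ.- t ℤ.* + K
    ≡⟨ ≡.cong₂ (λ x y → x ℤ.- y ℤ.- t ℤ.* + K) m+n≡Kwm (≡.cong +_ r+m≡K) ⟩
  + K ℤ.* + w ℤ.* + m ℤ.- + K ℤ.- t ℤ.* + K
    ≡⟨ solve 4 (λ K w m t → K :* w :* m :- K :- t :* K := (w :* m :- con (+ 1) :- t) :* K)
         ≡.refl (+ K) (+ w) (+ m) t ⟩
  (+ w ℤ.* + m ℤ.- + 1 ℤ.- t) ℤ.* + K ∎))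
  where
  open ≡.≡-Reasoning
  open ℤ-Solver
  n = Q-1 ℕ.* m
  r = n₀ ℤ.%ℕ K
  t = n₀ ℤ./ℕ K
  m+n≡Kwm : + m ℤ.+ + n ≡ + K ℤ.* + w ℤ.* + m
  m+n≡Kwm = begin
    + (suc Q-1 ℕ.* m)         ≡⟨ ≡.cong (λ x → + (x ℕ.* m)) Q≡Kw ⟩
    + (K ℕ.* w ℕ.* m)         ≡⟨ ℤ.pos-* (K ℕ.* w) m ⟩
    + (K ℕ.* w) ℤ.* + m       ≡⟨ ≡.cong (ℤ._* + m) (ℤ.pos-* K w) ⟩
    + K ℤ.* + w ℤ.* + m       ∎

-- Add Q ≤ s + d to itself and absorb s + s into one Q.
Q≤2d : ∀ {Q s d} → s ℕ.+ s ℕ.≤ Q → Q ℕ.≤ s ℕ.+ d → Q ℕ.≤ 2 ℕ.* d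
Q≤2d {Q} {s} {d} 2s≤Q Q≤s+d = ℕ.+-cancelˡ-≤ Q Q (2 ℕ.* d) (begin
  Q ℕ.+ Q                     ≤⟨ ℕ.+-mono-≤ Q≤s+d Q≤s+d ⟩
  (s ℕ.+ d) ℕ.+ (s ℕ.+ d)
    ≡⟨ solve 2 (λ s d → (s :+ d) :+ (s :+ d) := (s :+ s) :+ con 2 :* d) ≡.refl s d ⟩
  (s ℕ.+ s) ℕ.+ 2 ℕ.* d       ≤⟨ ℕ.+-monoˡ-≤ (2 ℕ.* d) 2s≤Q ⟩
  Q ℕ.+ 2 ℕ.* d               ∎)
  where
  open ℕ.≤-Reasoning
  open ℕ-Solver

-- The solutions n = m (q^e - 1) of n ≡ n₀, with m ≡ -n₀ (mod q^k) and e ≥ k.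
-- The term s stands for deg a + deg b.
record Exponent (q k : ℕ) (n₀ : ℤ) (N s : ℕ) : Set where
  field
    {e Q-1 m} : ℕ
    q^e≡Q  : q ℕ.^ e ≡ suc Q-1
    2≤Q    : 2 ℕ.≤ suc Q-1
    N<n    : N ℕ.< Q-1 ℕ.* m
    n≡n₀   : + (q ℕ.^ k) ℤ.∣ + (Q-1 ℕ.* m) ℤ.- n₀
    bound  : ∀ {d} → suc Q-1 ℕ.≤ s ℕ.+ d → Q-1 ℕ.* m ℕ.≤ 2 ℕ.* q ℕ.^ k ℕ.* d

exponent : ∀ {q} → 2 ℕ.≤ q → ∀ k n₀ N s → Exponent q k n₀ N s
exponent {q} 2≤q k n₀ N s = record
  { e     = e
  ; q^e≡Q = ≡.sym Q≡q^e
  ; 2≤Q   = ℕ.≤-trans (s≤s (ℕ.≤-trans (s≤s z≤n) N<e)) e<Q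
  ; N<n   = ℕ.≤-trans N<e (ℕ.≤-trans (ℕ.s≤s⁻¹ e<Q) (ℕ.m≤m*n Q-1 m))
  ; n≡n₀  = [Q-1]m≡n₀ {K} {q ℕ.^ e′} n₀
      (≡.trans Q≡q^e (ℕ.^-distribˡ-+-* q k e′)) (ℕ.m+[n∸m]≡n (ℕ.<⇒≤ r<K))
  ; bound = bound
  }
  where
  instance
    q≢0 : ℕ.NonZero q
    q≢0 = ℕ.>-nonZero (ℕ.≤-trans (s≤s z≤n) 2≤q)

  -- Since e < q^e, this one choice makes Q exceed both N and 2 s; the summand k in `e` makes q^k
  -- divide Q.
  e′ = suc (N ℕ.+ (s ℕ.+ s))
  e  = k ℕ.+ e′
  K  = q ℕ.^ k

  instance
    K≢0 : ℕ.NonZero K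
    K≢0 = ℕ.m^n≢0 q k

    q^e≢0 : ℕ.NonZero (q ℕ.^ e)
    q^e≢0 = ℕ.m^n≢0 q e

  r = n₀ ℤ.%ℕ K
  -- For r = 0 this takes K and not 0 as the representative of -n₀, which keeps n positive.
  m = K ℕ.∸ r
  Q-1 = ℕ.pred (q ℕ.^ e)

  r<K : r ℕ.< K
  r<K = ℤ.n%ℕd<d n₀ K

  instance
    m≢0 : ℕ.NonZero m
    m≢0 = ℕ.>-nonZero (ℕ.m<n⇒0<n∸m r<K)

  Q≡q^e : suc Q-1 ≡ q ℕ.^ e
  Q≡q^e = ℕ.suc-pred (q ℕ.^ e)

  e<Q : e ℕ.< suc Q-1
  e<Q = ≡.subst (e ℕ.<_) (≡.sym Q≡q^e) (n<m^n e 2≤q)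

  N<e : N ℕ.< e
  N<e = ℕ.≤-trans (s≤s (ℕ.m≤m+n N _)) (ℕ.m≤n+m e′ k)

  2s≤Q : s ℕ.+ s ℕ.≤ suc Q-1
  2s≤Q = ℕ.≤-trans (ℕ.≤-trans (ℕ.m≤n+m _ (suc N)) (ℕ.m≤n+m e′ k)) (ℕ.<⇒≤ e<Q)

  bound : ∀ {d} → suc Q-1 ℕ.≤ s ℕ.+ d → Q-1 ℕ.* m ℕ.≤ 2 ℕ.* K ℕ.* d
  bound {d} Q≤s+d = begin
    Q-1 ℕ.* m
      ≤⟨ ℕ.*-mono-≤ (ℕ.≤-trans (ℕ.n≤1+n Q-1) (Q≤2d {s = s} 2s≤Q Q≤s+d)) (ℕ.m∸n≤m K r) ⟩
    2 ℕ.* d ℕ.* K     ≡⟨ ℕ.*-assoc 2 d K ⟩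
    2 ℕ.* (d ℕ.* K)   ≡⟨ ≡.cong (2 ℕ.*_) (ℕ.*-comm d K) ⟩
    2 ℕ.* (K ℕ.* d)   ≡⟨ ℕ.*-assoc 2 K d ⟨
    2 ℕ.* K ℕ.* d     ∎
    where open ℕ.≤-Reasoning

theorem4 : ∀ {c ℓ₁ ℓ₂} (F : HeytingField c ℓ₁ ℓ₂) → let open Field F in
    (q : ℕ) → HasCardinality q →
    (a b : Poly) → Monic a → Nonconstant a → Monic b → Nonconstant b →
    (k : ℕ) → 1 ℕ.≤ k →
    ∃[ C ] 0ℚ ℚ.< C ×
    ((n₀ : ℤ) (N : ℕ) →
    ∃[ n ] N ℕ.< n ×
    (+ (q ℕ.^ k)) ℤ.∣ (+ n ℤ.- n₀) ×
    (∃[ g ] ∃[ d ] IsGCD (a ^ n - 1#) (b ^ n - 1#) g × HasDegree g d ×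
    C ℚ.* (+ n / 1) ℚ.≤ + d / 1))
theorem4 F zero card with () ← Inverse.to card (HeytingField.0# F)
theorem4 F q@(suc q-1) card a b _ (da , 0<da , ha) _ (db , _ , hb) k _ =
  + 1 / (2 ℕ.* q ℕ.^ k) ,
  ℚ.positive⁻¹ (+ 1 / (2 ℕ.* q ℕ.^ k)) {{ℚ.normalize-pos 1 (2 ℕ.* q ℕ.^ k)}} ,
  solution
  where
  open Field F
  R = HeytingCommutativeRing.commutativeRing (HeytingField.heytingCommutativeRing F)
  open PolynomialRing R using (_^ᴾ_; ^ᴾ≡^)
  open PolynomialDegree R using (Below-length)
  open FiniteField F q-1 card using (gcd; IsStrongGCD⇒IsGCD)
  open Frobenius F q-1 card using (2≤q; gcd-degree)

  instance
    2q^k≢0 : ℕ.NonZero (2 ℕ.* q ℕ.^ k)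
    2q^k≢0 = ℕ.m*n≢0 2 (q ℕ.^ k) {{_}} {{ℕ.m^n≢0 q k}}

  solution : ∀ n₀ N → ∃[ n ] N ℕ.< n × (+ (q ℕ.^ k)) ℤ.∣ (+ n ℤ.- n₀) ×
    (∃[ g ] ∃[ d ] IsGCD (a ^ n - 1#) (b ^ n - 1#) g × HasDegree g d ×
      (+ 1 / (2 ℕ.* q ℕ.^ k)) ℚ.* (+ n / 1) ℚ.≤ + d / 1)
  solution n₀ N =
    let open Exponent (exponent 2≤q k n₀ N (da ℕ.+ db))
        n = Q-1 ℕ.* m
        -- The length of the coefficient list bounds the degree and so bounds the recursion of
        -- `gcd`.
        g , isGCD = gcd _ (a ^ᴾ n - 1#) (b ^ᴾ n - 1#) (Below-length (b ^ᴾ n - 1#))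
        d , hg , Q≤deg = gcd-degree e q^e≡Q 2≤Q {a} {b} 0<da ha hb m (ℕ.m<n⇒0<n N<n) isGCD
    in n , N<n , n≡n₀ , g , d ,
       ≡.subst₂ (λ x y → IsGCD (x - 1#) (y - 1#) g) (^ᴾ≡^ a n) (^ᴾ≡^ b n)
         (IsStrongGCD⇒IsGCD isGCD) ,
       hg , 1/K*n≤d {2 ℕ.* q ℕ.^ k} {n} {d} (bound {d} Q≤deg)
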